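{- Let ${\cal F}$ be a Fano plane, $\epsilon$ a composition factor, $g\in\mathrm{Aut}({\cal F})$ and $\tilde\delta:{\cal F}\to S_2$. Define $\hat g:\hat{\cal F}_\epsilon\to\hat{\cal F}_\epsilon$ by $\hat g(\pm e_P)=\pm\tilde\delta(P)e_{g(P)}$. Then $\hat g\in\mathrm{Aut}(\hat{\cal F}_\epsilon)$ if and only if for every line $D=\{P,Q,R\}$ one has $\delta^\ast(g,D)=\tilde\delta(P)\tilde\delta(Q)\tilde\delta(R)$; and in this case $\pi(\hat g)=g$.
   Context: $\mathbb F$ is a field of characteristic not $2$; ${\cal F}$ is a Fano plane (seven points, seven lines) with set of lines ${\cal F}^\ast$; for distinct $P,Q$, $P+Q$ is the third point of the line through them. $\mathrm{Aut}({\cal F})$ is the group of bijections sending lines to lines; $S_2=\{1,-1\}$. $\mathbb O_{\cal F}$ has $\mathbb F$-basis $1,e_P$ ($P\in{\cal F}$); a multiplication factor $\epsilon$ (antisymmetric $S_2$-valued function of pairs of distinct points) defines the product with unit $1$, $e_Pe_Q=\epsilon_{PQ}e_{P+Q}$ ($P\neq Q$), $e_P^2=-1$; $\epsilon$ is a composition factor if the norm $N(\lambda^01+\sum\lambda^Pe_P)=(\lambda^0)^2+\sum(\lambda^P)^2$ is multiplicative. For $g\in\mathrm{Aut}({\cal F})$ and a line $D$, $\delta^\ast(g,D)=\epsilon_{PQ}\epsilon_{g(P)g(Q)}$ for any distinct $P,Q\in D$ (independent of the choice). $\hat{\cal F}_\epsilon=\{\pm e_P:P\in{\cal F}\}\subset\mathbb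 O_{\cal F}$, and $\mathrm{Aut}(\hat{\cal F}_\epsilon)$ is the set of maps $\hat h:\hat{\cal F}_\epsilon\to\hat{\cal F}_\epsilon$ with $\hat h(-e_P)=-\hat h(e_P)$ for all $P$ and $\hat h(e_Pe_Q)=\hat h(e_P)\hat h(e_Q)$ for all $P\ne Q$. $\pi:\mathrm{Aut}(\hat{\cal F}_\epsilon)\to\mathrm{Aut}({\cal F})$ is the homomorphism induced on ${\cal F}=\hat{\cal F}_\epsilon/\{\pm1\}$ (i.e. $\hat h(e_P)=\pm e_{\pi(\hat h)(P)}$). -}

module Defs where

open import Level using (Level; _⊔_) renaming (suc to lsuc)
open import Algebra.Bundles using (CommutativeRing)
open import Data.Fin using (Fin; zero; suc)
open import Data.Nat using (ℕ)
open import Data.Maybe using (Maybe; just; nothing)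
open import Data.Product using (Σ; ∃; ∃!; _×_; _,_; proj₁; proj₂)
open import Data.Sum using (_⊎_)
open import Data.Sign using (Sign; opposite) renaming (_*_ to _·ₛ_)
import Data.Sign as S
open import Function.Bundles using (_↔_; _⇔_; Inverse)
open import Function.Definitions using (Bijective)
open import Relation.Binary.Definitions using (DecidableEquality)
open import Relation.Binary.PropositionalEquality using (_≡_; _≢_)
open import Relation.Nullary using (¬_; yes; no)

------------------------------------------------------------------------
-- Fields (not in agda-stdlib): a commutative ring with 0 ≉ 1 in which
-- every nonzero element has a multiplicative inverse.

record Field (c ℓ : Level) : Set (lsuc (c ⊔ ℓ)) where
  field
    commutativeRing : CommutativeRing c ℓ
  open CommutativeRing commutativeRing public
  field
    0≉1     : ¬ (0# ≈ 1#)
    inverse : ∀ x → ¬ (x ≈ 0#) → ∃ λ y → (x * y) ≈ 1#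

-- characteristic not 2
CharNot2 : ∀ {c ℓ} → Field c ℓ → Set ℓ
CharNot2 F = ¬ ((1# + 1#) ≈ 0#) where open Field F

------------------------------------------------------------------------
-- Fano planes: a 7-element set of points together with its 7 lines,
-- each line being a set of three distinct points, such that any two
-- distinct points lie on exactly one line.  Lines are indexed by Fin 7
-- (the uniqueness axiom forces the 7 lines to be pairwise distinct).

-- X is one of the three entries of the triple
OnTriple : {A : Set} → A → A × A × A → Set
OnTriple X (A , B , C) = X ≡ A ⊎ X ≡ B ⊎ X ≡ C

-- the three entries are pairwise distinct
Distinct3 : {A : Set} → A × A × A → Set
Distinct3 (A , B , C) = A ≢ B × A ≢ C × B ≢ C

record FanoPlane : Set₁ where
  field
    Point   : Set
    _≟_     : DecidableEquality Point
    enum    : Point ↔ Fin 7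
    line    : Fin 7 → Point × Point × Point

    line-distinct : ∀ L → Distinct3 (line L)
    unique-line   : ∀ P Q → P ≢ Q →
                    ∃! _≡_ (λ L → OnTriple P (line L) × OnTriple Q (line L))

  -- X lies on the line with index L
  _∈ₗ_ : Point → Fin 7 → Set
  X ∈ₗ L = OnTriple X (line L)

  -- the point with index i
  pt : Fin 7 → Point
  pt = Inverse.from enum

  private
    pick : Point → Point → Point × Point × Point → Point
    pick P Q (A , B , C) with A ≟ P | A ≟ Q
    ... | no _ | no _ = A
    ... | _ | _ with B ≟ P | B ≟ Q
    ... | no _ | no _ = B
    ... | _ | _ = C

  -- P + Q : the third point of the line through distinct P, Q
  -- (for P = Q the value is irrelevant and set to P).
  infixl 6 _+_
  _+_ : Point → Point → Point
  P + Q with P ≟ Q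
  ... | yes _ = P
  ... | no P≢Q = pick P Q (line (proj₁ (unique-line P Q P≢Q)))

open FanoPlane public using (Point)

-- Aut(F): bijections of the points sending lines to lines.
IsFanoAut : (𝓕 : FanoPlane) → (Point 𝓕 → Point 𝓕) → Set
IsFanoAut 𝓕 g =
  Bijective _≡_ _≡_ g ×
  (∀ L → ∃ λ L′ → ∀ X → (X ∈ₗ L′) ⇔ (∃ λ Y → Y ∈ₗ L × g Y ≡ X))
  where open FanoPlane 𝓕

------------------------------------------------------------------------
-- Multiplication factors: antisymmetric S₂-valued functions of pairs of
-- distinct points (values on the diagonal are irrelevant).

IsMultiplicationFactor : (𝓕 : FanoPlane) → (Point 𝓕 → Point 𝓕 → Sign) → Set
IsMultiplicationFactor 𝓕 ε = ∀ P Q → P ≢ Q → ε Q P ≡ opposite (ε P Q)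

-- δ*(g, D) = ε_{PQ} ε_{g(P) g(Q)} computed with the first two points
-- P, Q of the line D (independent of the choice, per the context).
deltaStar : (𝓕 : FanoPlane) → (Point 𝓕 → Point 𝓕 → Sign) →
            (Point 𝓕 → Point 𝓕) → Fin 7 → Sign
deltaStar 𝓕 ε g L with FanoPlane.line 𝓕 L
... | (P , Q , _) = ε P Q ·ₛ ε (g P) (g Q)

------------------------------------------------------------------------
-- The algebra 𝕆_F and the set F̂_ε = {± e_P}.

module Octonions {c ℓ} (F : Field c ℓ) (𝓕 : FanoPlane)
                 (ε : Point 𝓕 → Point 𝓕 → Sign) where
  open Field F hiding (zero)
  open FanoPlane 𝓕 hiding (_+_)
  open FanoPlane 𝓕 using () renaming (_+_ to _⊕_)

  -- sum over Fin n
  sumFin : ∀ {n} → (Fin n → Carrier) → Carrier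
  sumFin {ℕ.zero}  f = 0#
  sumFin {ℕ.suc n} f = f zero + sumFin (λ i → f (suc i))

  -- sum over the points of the Fano plane
  sumPt : (Point 𝓕 → Carrier) → Carrier
  sumPt f = sumFin (λ i → f (pt i))

  -- s · x for s ∈ S₂
  signed : Sign → Carrier → Carrier
  signed S.+ x = x
  signed S.- x = - x

  -- an element λ⁰ 1 + Σ λᴾ e_P : coordinate `nothing` is λ⁰,
  -- coordinate `just P` is λᴾ
  Oct : Set c
  Oct = Maybe (Point 𝓕) → Carrier

  -- bilinear extension of 1 unit, e_P e_Q = ε_{PQ} e_{P+Q} (P ≠ Q),
  -- e_P² = -1
  mul : Oct → Oct → Oct
  mul a b nothing =
    a nothing * b nothing - sumPt (λ P → a (just P) * b (just P))
  mul a b (just R) =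
    a nothing * b (just R) + a (just R) * b nothing +
    sumPt (λ P → sumPt (λ Q → term P Q))
    where
    term : Point 𝓕 → Point 𝓕 → Carrier
    term P Q with P ≟ Q
    ... | yes _ = 0#
    ... | no _ with (P ⊕ Q) ≟ R
    ...   | yes _ = signed (ε P Q) (a (just P) * b (just Q))
    ...   | no _  = 0#

  norm : Oct → Carrier
  norm a = a nothing * a nothing + sumPt (λ P → a (just P) * a (just P))

  IsCompositionFactor : Set (c ⊔ ℓ)
  IsCompositionFactor =
    IsMultiplicationFactor 𝓕 ε × (∀ a b → norm (mul a b) ≈ (norm a * norm b))

  -- elements of F̂_ε: (s , P) stands for s e_P
  Hat : Set
  Hat = Sign × Point 𝓕

  -- the element s e_P of 𝕆_F
  ι : Hat → Oct
  ι (s , P) nothing = 0#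
  ι (s , P) (just X) with P ≟ X
  ... | yes _ = signed s 1#
  ... | no _  = 0#

  negHat : Hat → Hat
  negHat (s , P) = (opposite s , P)

  -- Aut(F̂_ε): ĥ(-e_P) = -ĥ(e_P) and ĥ(e_P e_Q) = ĥ(e_P) ĥ(e_Q) for
  -- P ≠ Q, where e_P e_Q = ε_{PQ} e_{P+Q} and the right-hand product is
  -- taken in 𝕆_F.
  IsAutHat : (Hat → Hat) → Set ℓ
  IsAutHat h =
    (∀ P → h (S.- , P) ≡ negHat (h (S.+ , P))) ×
    (∀ P Q → P ≢ Q → ∀ k →
       ι (h (ε P Q , P ⊕ Q)) k ≈ mul (ι (h (S.+ , P))) (ι (h (S.+ , Q))) k)

  -- π(ĥ)(P) is the point with ĥ(e_P) = ± e_{π(ĥ)(P)}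
  πHat : (Hat → Hat) → Point 𝓕 → Point 𝓕
  πHat h P = proj₂ (h (S.+ , P))

  -- ĝ(± e_P) = ± δ̃(P) e_{g(P)}
  ghat : (Point 𝓕 → Point 𝓕) → (Point 𝓕 → Sign) → Hat → Hat
  ghat g δ̃ (s , P) = (s ·ₛ δ̃ P , g P)

-- apply a predicate to the three points (P , Q , R) of the line D
OnLineTriple : (𝓕 : FanoPlane) → Fin 7 →
               (Point 𝓕 → Point 𝓕 → Point 𝓕 → Set) → Set
OnLineTriple 𝓕 D K with FanoPlane.line 𝓕 D
... | (P , Q , R) = K P Q R

-- For P ≠ Q, ĝ(e_P) ĝ(e_Q) = ε_{g(P)g(Q)} δ̃(P) δ̃(Q) e_{g(P)+g(Q)} while ĝ(e_P e_Q) = ε_{PQ} δ̃(P+Q) e_{g(P+Q)}.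
-- As g(P+Q) = g(P) + g(Q) and e_R ≠ -e_R in characteristic ≠ 2, ĝ is multiplicative exactly when
-- δ*(P,Q) := ε_{PQ} ε_{g(P)g(Q)} equals δ̃(P) δ̃(Q) δ̃(P+Q) for all P ≠ Q. Both sides are unchanged by
-- (P,Q) ↦ (Q,P) and (P,Q) ↦ (Q,P+Q), which connect all ordered pairs of a line, so it suffices to
-- check one pair per line: that is the line condition. For δ* the cycle invariance rests on
-- ε_{PQ} = ε_{Q,P+Q}, forced by the composition property: otherwise the norm of (1 + e_Q)(e_P + e_{P+Q})
-- would be 0 or 8 instead of N(1 + e_Q) N(e_P + e_{P+Q}) = 4.

module Submission where

open import Defs
open import Data.Fin using (Fin)
open import Data.Product using (_×_; _,_)
open import Data.Sign using (Sign) renaming (_*_ to _·ₛ_)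
open import Function.Bundles using (_⇔_)
open import Relation.Binary.PropositionalEquality using (_≡_)

open import Data.Fin using (zero; suc; punchIn; punchOut)
open import Data.Fin.Properties using (punchInᵢ≢i; punchIn-punchOut; punchOut-punchIn; punchOut-cong)
import Data.Nat as ℕ
open import Data.Maybe using (nothing; just)
open import Data.Product using (Σ; ∃; proj₁; proj₂)
open import Data.Sign as Sign using (opposite)
import Data.Sign.Properties as Signₚ
open import Data.Sum using (inj₁; inj₂)
open import Data.Vec.Functional using (removeAt)
open import Function.Base using (_∘_)
open import Function.Bundles using (Inverse; Equivalence; mk⇔)
open import Function.Construct.Composition using (_⇔-∘_)
open import Relation.Binary.PropositionalEquality as ≡ using (_≢_; refl; ≢-sym)
open import Relation.Nullary using (¬_; yes; no)
open import Relation.Nullary.Negation using (contradiction)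
import Relation.Binary.Reasoning.Setoid as SetoidReasoning
open import Algebra.Bundles using (CommutativeMonoid)

-- Signs

module _ where
  open import Algebra.Solver.CommutativeMonoid Signₚ.*-commutativeMonoid using (solve; _⊕_; _⊜_)
  open ≡.≡-Reasoning

  ·ₛ-square-cancel : ∀ a r → a ·ₛ (r ·ₛ r) ≡ a
  ·ₛ-square-cancel a r = ≡.trans (≡.cong (a ·ₛ_) (Signₚ.s*s≡+ r)) (Signₚ.*-identityʳ a)

  ·ₛ-swap-middle : ∀ x r y s → x ·ₛ r ≡ y ·ₛ s → x ·ₛ y ≡ r ·ₛ s
  ·ₛ-swap-middle x r y s xr≡ys = begin
    x ·ₛ y                    ≡⟨ ·ₛ-square-cancel (x ·ₛ y) r ⟨
    x ·ₛ y ·ₛ (r ·ₛ r)        ≡⟨ solve 3 (λ x y r → (x ⊕ y) ⊕ (r ⊕ r) ⊜ (x ⊕ r) ⊕ (y ⊕ r)) refl x y r ⟩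
    x ·ₛ r ·ₛ (y ·ₛ r)        ≡⟨ ≡.cong (_·ₛ (y ·ₛ r)) xr≡ys ⟩
    y ·ₛ s ·ₛ (y ·ₛ r)        ≡⟨ solve 3 (λ y s r → (y ⊕ s) ⊕ (y ⊕ r) ⊜ (r ⊕ s) ⊕ (y ⊕ y)) refl y s r ⟩
    r ·ₛ s ·ₛ (y ·ₛ y)        ≡⟨ ·ₛ-square-cancel (r ·ₛ s) y ⟩
    r ·ₛ s                    ∎

  opposite-·ₛ-opposite : ∀ x y → opposite x ·ₛ opposite y ≡ x ·ₛ y
  opposite-·ₛ-opposite Sign.+ y = Signₚ.opposite-involutive y
  opposite-·ₛ-opposite Sign.- y = refl

  ·ₛ-transpose : ∀ x y r s → x ·ₛ r ≡ y ·ₛ s ⇔ x ·ₛ y ≡ s ·ₛ r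
  ·ₛ-transpose x y r s = mk⇔ (λ xr≡ys → ≡.trans (·ₛ-swap-middle x r y s xr≡ys) (Signₚ.*-comm r s))
                             (λ xy≡sr → ·ₛ-swap-middle x y r s (≡.trans xy≡sr (Signₚ.*-comm s r)))

  ≢⇒≡opposite : ∀ {x y} → x ≢ y → x ≡ opposite y
  ≢⇒≡opposite {Sign.+} {Sign.+} x≢y = contradiction refl x≢y
  ≢⇒≡opposite {Sign.+} {Sign.-} _   = refl
  ≢⇒≡opposite {Sign.-} {Sign.+} _   = refl
  ≢⇒≡opposite {Sign.-} {Sign.-} x≢y = contradiction refl x≢y

-- Triples and Fano planes

module _ {A : Set} where

  OnTriple-rotate : ∀ {X P Q R : A} → OnTriple X (P , Q , R) → OnTriple X (Q , R , P)
  OnTriple-rotate (inj₁ X≡P)        = inj₂ (inj₂ X≡P)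
  OnTriple-rotate (inj₂ (inj₁ X≡Q)) = inj₁ X≡Q
  OnTriple-rotate (inj₂ (inj₂ X≡R)) = inj₂ (inj₁ X≡R)

  OnTriple-last : ∀ {X P Q R : A} → OnTriple X (P , Q , R) → X ≢ P → X ≢ Q → X ≡ R
  OnTriple-last (inj₁ X≡P)        X≢P _   = contradiction X≡P X≢P
  OnTriple-last (inj₂ (inj₁ X≡Q)) _   X≢Q = contradiction X≡Q X≢Q
  OnTriple-last (inj₂ (inj₂ X≡R)) _   _   = X≡R

  OnTriple-avoiding-unique : ∀ {t : A × A × A} {X Y W Z} → X ≢ Y →
    OnTriple X t → OnTriple Y t → OnTriple W t → OnTriple Z t →
    X ≢ W → Y ≢ W → X ≢ Z → Y ≢ Z → W ≡ Z
  OnTriple-avoiding-unique {t} {X} {Y} {W} {Z} X≢Y X∈ Y∈ W∈ Z∈ X≢W Y≢W X≢Z Y≢Z = cases W∈ Z∈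
    where
    both : ∀ {P Q R} → OnTriple X (P , Q , R) → OnTriple Y (P , Q , R) →
           X ≢ P → Y ≢ P → X ≢ Q → Y ≢ Q → ∀ {B : Set} → B
    both X∈′ Y∈′ X≢P Y≢P X≢Q Y≢Q =
      contradiction (≡.trans (OnTriple-last X∈′ X≢P X≢Q) (≡.sym (OnTriple-last Y∈′ Y≢P Y≢Q))) X≢Y
    rot² : ∀ {V P Q R} → OnTriple V (P , Q , R) → OnTriple V (R , P , Q)
    rot² = OnTriple-rotate ∘ OnTriple-rotate
    cases : OnTriple W t → OnTriple Z t → W ≡ Z
    cases (inj₁ refl)        (inj₁ refl)        = refl
    cases (inj₁ refl)        (inj₂ (inj₁ refl)) = both X∈ Y∈ X≢W Y≢W X≢Z Y≢Z
    cases (inj₁ refl)        (inj₂ (inj₂ refl)) = both (rot² X∈) (rot² Y∈) X≢Z Y≢Z X≢W Y≢W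
    cases (inj₂ (inj₁ refl)) (inj₁ refl)        = both X∈ Y∈ X≢Z Y≢Z X≢W Y≢W
    cases (inj₂ (inj₁ refl)) (inj₂ (inj₁ refl)) = refl
    cases (inj₂ (inj₁ refl)) (inj₂ (inj₂ refl)) = both (OnTriple-rotate X∈) (OnTriple-rotate Y∈) X≢W Y≢W X≢Z Y≢Z
    cases (inj₂ (inj₂ refl)) (inj₁ refl)        = both (rot² X∈) (rot² Y∈) X≢W Y≢W X≢Z Y≢Z
    cases (inj₂ (inj₂ refl)) (inj₂ (inj₁ refl)) = both (OnTriple-rotate X∈) (OnTriple-rotate Y∈) X≢Z Y≢Z X≢W Y≢W
    cases (inj₂ (inj₂ refl)) (inj₂ (inj₂ refl)) = refl

module FanoGeometry (𝓕 : FanoPlane) where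
  open FanoPlane 𝓕 renaming (_+_ to _⊕_)

  ⊕-on-line : ∀ {X Y L} → X ≢ Y → X ∈ₗ L → Y ∈ₗ L → (X ⊕ Y) ∈ₗ L × X ⊕ Y ≢ X × X ⊕ Y ≢ Y
  ⊕-on-line {X} {Y} {L} X≢Y X∈L Y∈L with X ≟ Y
  ... | yes X≡Y = contradiction X≡Y X≢Y
  ... | no X≢Y′ with unique-line X Y X≢Y′
  ...   | _ , _ , unique with unique (X∈L , Y∈L)
  ...     | refl with line L | line-distinct L
  ...       | (A , B , C) | (A≢B , A≢C , B≢C) with A ≟ X | A ≟ Y
  ...         | no A≢X  | no A≢Y = inj₁ refl , A≢X , A≢Y
  ...         | yes A≡X | _ with B ≟ X | B ≟ Y
  ...           | no B≢X  | no B≢Y  = inj₂ (inj₁ refl) , B≢X , B≢Y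
  ...           | yes B≡X | _       = contradiction (≡.trans A≡X (≡.sym B≡X)) A≢B
  ...           | no _    | yes B≡Y =
    inj₂ (inj₂ refl) , (λ C≡X → A≢C (≡.trans A≡X (≡.sym C≡X))) , (λ C≡Y → B≢C (≡.trans B≡Y (≡.sym C≡Y)))
  ⊕-on-line {X} {Y} {L} _ _ _ | no _ | _ , _ , _ | refl | (A , B , C) | (A≢B , A≢C , B≢C) | no _ | yes A≡Y
    with B ≟ X | B ≟ Y
  ...           | no B≢X  | no B≢Y  = inj₂ (inj₁ refl) , B≢X , B≢Y
  ...           | yes B≡X | _       =
    inj₂ (inj₂ refl) , (λ C≡X → B≢C (≡.trans B≡X (≡.sym C≡X))) , (λ C≡Y → A≢C (≡.trans A≡Y (≡.sym C≡Y)))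
  ...           | no _    | yes B≡Y = contradiction (≡.trans A≡Y (≡.sym B≡Y)) A≢B

  ⊕-unique : ∀ {X Y Z L} → X ≢ Y → X ≢ Z → Y ≢ Z → X ∈ₗ L → Y ∈ₗ L → Z ∈ₗ L → X ⊕ Y ≡ Z
  ⊕-unique X≢Y X≢Z Y≢Z X∈L Y∈L Z∈L with ⊕-on-line X≢Y X∈L Y∈L
  ... | X⊕Y∈L , X⊕Y≢X , X⊕Y≢Y =
    OnTriple-avoiding-unique X≢Y X∈L Y∈L X⊕Y∈L Z∈L (≢-sym X⊕Y≢X) (≢-sym X⊕Y≢Y) X≢Z Y≢Z

  line-through : ∀ {X Y} → X ≢ Y → ∃ λ L → X ∈ₗ L × Y ∈ₗ L
  line-through X≢Y = proj₁ (unique-line _ _ X≢Y) , proj₁ (proj₂ (unique-line _ _ X≢Y))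

  ⊕-collinear : ∀ {X Y} → X ≢ Y →
                ∃ λ L → X ∈ₗ L × Y ∈ₗ L × (X ⊕ Y) ∈ₗ L × X ⊕ Y ≢ X × X ⊕ Y ≢ Y
  ⊕-collinear X≢Y with line-through X≢Y
  ... | L , X∈L , Y∈L = L , X∈L , Y∈L , ⊕-on-line X≢Y X∈L Y∈L

  ⊕-comm : ∀ {X Y} → X ≢ Y → Y ⊕ X ≡ X ⊕ Y
  ⊕-comm X≢Y with ⊕-collinear X≢Y
  ... | _ , X∈L , Y∈L , Z∈L , Z≢X , Z≢Y = ⊕-unique (≢-sym X≢Y) (≢-sym Z≢Y) (≢-sym Z≢X) Y∈L X∈L Z∈L

  ⊕-cycle : ∀ {X Y} → X ≢ Y → Y ⊕ (X ⊕ Y) ≡ X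
  ⊕-cycle X≢Y with ⊕-collinear X≢Y
  ... | _ , X∈L , Y∈L , Z∈L , Z≢X , Z≢Y = ⊕-unique (≢-sym Z≢Y) (≢-sym X≢Y) Z≢X Y∈L Z∈L X∈L

  ⊕-≢ˡ : ∀ {X Y} → X ≢ Y → X ⊕ Y ≢ X
  ⊕-≢ˡ X≢Y with ⊕-collinear X≢Y
  ... | _ , _ , _ , _ , Z≢X , _ = Z≢X

  ⊕-≢ʳ : ∀ {X Y} → X ≢ Y → X ⊕ Y ≢ Y
  ⊕-≢ʳ X≢Y with ⊕-collinear X≢Y
  ... | _ , _ , _ , _ , _ , Z≢Y = Z≢Y

  module LinePoints (D : Fin 7) where
    A B C : Point 𝓕
    A = proj₁ (line D)
    B = proj₁ (proj₂ (line D))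
    C = proj₂ (proj₂ (line D))

    A≢B : A ≢ B
    A≢B = proj₁ (line-distinct D)

    A≢C : A ≢ C
    A≢C = proj₁ (proj₂ (line-distinct D))

    B≢C : B ≢ C
    B≢C = proj₂ (proj₂ (line-distinct D))

    A⊕B≡C : A ⊕ B ≡ C
    A⊕B≡C = ⊕-unique A≢B A≢C B≢C (inj₁ refl) (inj₂ (inj₁ refl)) (inj₂ (inj₂ refl))

    B⊕C≡A : B ⊕ C ≡ A
    B⊕C≡A = ≡.subst (λ X → B ⊕ X ≡ A) A⊕B≡C (⊕-cycle A≢B)

  line-invariant : ∀ {S : Set} (f : Point 𝓕 → Point 𝓕 → S) →
    (∀ {P Q} → P ≢ Q → f Q P ≡ f P Q) → (∀ {P Q} → P ≢ Q → f Q (P ⊕ Q) ≡ f P Q) →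
    ∀ D {P Q} → P ∈ₗ D → Q ∈ₗ D → P ≢ Q → OnLineTriple 𝓕 D (λ A B _ → f P Q ≡ f A B)
  line-invariant f swap cycle D = on-pairs
    where
    open LinePoints D
    fBC : f B C ≡ f A B
    fBC = ≡.subst (λ X → f B X ≡ f A B) A⊕B≡C (cycle A≢B)
    fCA : f C A ≡ f A B
    fCA = ≡.subst (λ X → f C X ≡ f A B) B⊕C≡A (≡.trans (cycle B≢C) fBC)
    on-pairs : ∀ {P Q} → P ∈ₗ D → Q ∈ₗ D → P ≢ Q → f P Q ≡ f A B
    on-pairs (inj₁ refl)        (inj₁ refl)        P≢Q = contradiction refl P≢Q
    on-pairs (inj₁ refl)        (inj₂ (inj₁ refl)) _   = refl
    on-pairs (inj₁ refl)        (inj₂ (inj₂ refl)) _   = ≡.trans (swap (≢-sym A≢C)) fCA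
    on-pairs (inj₂ (inj₁ refl)) (inj₁ refl)        _   = swap A≢B
    on-pairs (inj₂ (inj₁ refl)) (inj₂ (inj₁ refl)) P≢Q = contradiction refl P≢Q
    on-pairs (inj₂ (inj₁ refl)) (inj₂ (inj₂ refl)) _   = fBC
    on-pairs (inj₂ (inj₂ refl)) (inj₁ refl)        _   = fCA
    on-pairs (inj₂ (inj₂ refl)) (inj₂ (inj₁ refl)) _   = ≡.trans (swap B≢C) fBC
    on-pairs (inj₂ (inj₂ refl)) (inj₂ (inj₂ refl)) P≢Q = contradiction refl P≢Q

  module _ {g : Point 𝓕 → Point 𝓕} (aut : IsFanoAut 𝓕 g) where

    aut-≢ : ∀ {X Y} → X ≢ Y → g X ≢ g Y
    aut-≢ X≢Y = X≢Y ∘ proj₁ (proj₁ aut)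

    aut-⊕ : ∀ {X Y} → X ≢ Y → g (X ⊕ Y) ≡ g X ⊕ g Y
    aut-⊕ {X} {Y} X≢Y with ⊕-collinear X≢Y
    ... | L , X∈L , Y∈L , Z∈L , Z≢X , Z≢Y with proj₂ aut L
    ...   | L′ , image = ≡.sym (⊕-unique (aut-≢ X≢Y) (aut-≢ (≢-sym Z≢X)) (aut-≢ (≢-sym Z≢Y))
                                          (maps-to X∈L) (maps-to Y∈L) (maps-to Z∈L))
      where
      maps-to : ∀ {V} → V ∈ₗ L → g V ∈ₗ L′
      maps-to {V} V∈L = Equivalence.from (image (g V)) (V , V∈L , refl)

-- Finite sums

module FinSum {a ℓ} (M : CommutativeMonoid a ℓ) where
  open CommutativeMonoid M renaming (_∙_ to _+_; ε to 0#; ∙-congˡ to +-congˡ; identityʳ to +-identityʳ)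
  open import Algebra.Properties.CommutativeMonoid.Sum M using (sum; sum-remove; sum-cong-≋; sum-replicate-zero)
  open SetoidReasoning setoid

  sum-zero : ∀ {n} (f : Fin n → Carrier) → (∀ i → f i ≈ 0#) → sum f ≈ 0#
  sum-zero {n} f f≈0 = trans (sum-cong-≋ f≈0) (sum-replicate-zero n)

  sum-single : ∀ {n} (f : Fin (ℕ.suc n) → Carrier) i → (∀ j → j ≢ i → f j ≈ 0#) → sum f ≈ f i
  sum-single f i f≈0 = begin
    sum f                     ≈⟨ sum-remove {i = i} f ⟩
    f i + sum (removeAt f i)  ≈⟨ +-congˡ (sum-zero (removeAt f i) (λ j → f≈0 (punchIn i j) (punchInᵢ≢i i j))) ⟩
    f i + 0#                  ≈⟨ +-identityʳ (f i) ⟩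
    f i                       ∎

  sum-pair : ∀ {n} (f : Fin (ℕ.suc (ℕ.suc n)) → Carrier) {i j} → i ≢ j →
             (∀ k → k ≢ i → k ≢ j → f k ≈ 0#) → sum f ≈ f i + f j
  sum-pair f {i} {j} i≢j f≈0 = begin
    sum f                               ≈⟨ sum-remove {i = i} f ⟩
    f i + sum (removeAt f i)            ≈⟨ +-congˡ (sum-single (removeAt f i) (punchOut i≢j) off-j) ⟩
    f i + f (punchIn i (punchOut i≢j))  ≡⟨ ≡.cong (λ k → f i + f k) (punchIn-punchOut i≢j) ⟩
    f i + f j                           ∎
    where
    off-j : ∀ k → k ≢ punchOut i≢j → f (punchIn i k) ≈ 0#
    off-j k k≢ = f≈0 (punchIn i k) (punchInᵢ≢i i k)
                     (λ e → k≢ (≡.trans (≡.sym (punchOut-punchIn i)) (punchOut-cong i e)))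

-- The algebra 𝕆_F

module OctonionAlgebra {c ℓ} (F : Field c ℓ) (𝓕 : FanoPlane) (ε : Point 𝓕 → Point 𝓕 → Sign) where
  open Field F hiding (zero; refl)
  open Field F using () renaming (refl to ≈-refl)
  open Octonions F 𝓕 ε
  open FanoPlane 𝓕 using (_≟_; pt; enum) renaming (_+_ to _⊕_)
  open FanoGeometry 𝓕
  open FinSum +-commutativeMonoid
  open import Algebra.Properties.Ring ring using (-0#≈0#; -‿involutive; -1*x≈-x; x+x≈x⇒x≈0)
  open SetoidReasoning setoid

  private
    Pt : Set
    Pt = Point 𝓕

  index : Pt → Fin 7
  index = Inverse.to enum

  pt≢ : ∀ {j P} → j ≢ index P → pt j ≢ P
  pt≢ j≢ pt≡ = j≢ (≡.sym (Inverse.inverseˡ enum (≡.sym pt≡)))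

  pt-index : ∀ P → pt (index P) ≡ P
  pt-index = Inverse.strictlyInverseʳ enum

  sumPt-zero : ∀ (f : Pt → Carrier) → (∀ X → f X ≈ 0#) → sumPt f ≈ 0#
  sumPt-zero f f≈0 = sum-zero (f ∘ pt) (f≈0 ∘ pt)

  sumPt-single : ∀ (f : Pt → Carrier) P → (∀ X → X ≢ P → f X ≈ 0#) → sumPt f ≈ f P
  sumPt-single f P f≈0 = begin
    sumPt f            ≈⟨ sum-single (f ∘ pt) (index P) (λ j j≢ → f≈0 (pt j) (pt≢ j≢)) ⟩
    f (pt (index P))   ≡⟨ ≡.cong f (pt-index P) ⟩
    f P                ∎

  sumPt-pair : ∀ (f : Pt → Carrier) {P Q} → P ≢ Q → (∀ X → X ≢ P → X ≢ Q → f X ≈ 0#) →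
               sumPt f ≈ f P + f Q
  sumPt-pair f {P} {Q} P≢Q f≈0 = begin
    sumPt f                            ≈⟨ sum-pair (f ∘ pt) index≢ (λ k k≢P k≢Q → f≈0 (pt k) (pt≢ k≢P) (pt≢ k≢Q)) ⟩
    f (pt (index P)) + f (pt (index Q)) ≡⟨ ≡.cong₂ (λ X Y → f X + f Y) (pt-index P) (pt-index Q) ⟩
    f P + f Q                          ∎
    where
    index≢ : index P ≢ index Q
    index≢ e = P≢Q (≡.trans (≡.sym (pt-index P)) (≡.trans (≡.cong pt e) (pt-index Q)))

  signed-cong : ∀ s {x y} → x ≈ y → signed s x ≈ signed s y
  signed-cong Sign.+ x≈y = x≈y
  signed-cong Sign.- x≈y = -‿cong x≈y

  signed-0 : ∀ s → signed s 0# ≈ 0#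
  signed-0 Sign.+ = ≈-refl
  signed-0 Sign.- = -0#≈0#

  signed-signed : ∀ s t x → signed s (signed t x) ≈ signed (s ·ₛ t) x
  signed-signed Sign.+ t      x = ≈-refl
  signed-signed Sign.- Sign.+ x = ≈-refl
  signed-signed Sign.- Sign.- x = -‿involutive x

  signed-1-* : ∀ s t → signed s 1# * signed t 1# ≈ signed (s ·ₛ t) 1#
  signed-1-* Sign.+ t      = *-identityˡ (signed t 1#)
  signed-1-* Sign.- Sign.+ = *-identityʳ (- 1#)
  signed-1-* Sign.- Sign.- = trans (-1*x≈-x (- 1#)) (-‿involutive 1#)

  1≉-1 : CharNot2 F → ¬ (1# ≈ - 1#)
  1≉-1 ch2 1≈-1 = ch2 (trans (+-congʳ 1≈-1) (-‿inverseˡ 1#))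

  signed-1-injective : CharNot2 F → ∀ {s t} → signed s 1# ≈ signed t 1# → s ≡ t
  signed-1-injective ch2 {Sign.+} {Sign.+} _    = refl
  signed-1-injective ch2 {Sign.+} {Sign.-} 1≈-1 = contradiction 1≈-1 (1≉-1 ch2)
  signed-1-injective ch2 {Sign.-} {Sign.+} -1≈1 = contradiction (sym -1≈1) (1≉-1 ch2)
  signed-1-injective ch2 {Sign.-} {Sign.-} _    = refl

  ι-at : ∀ s X → ι (s , X) (just X) ≈ signed s 1#
  ι-at s X with X ≟ X
  ... | yes _   = ≈-refl
  ... | no X≢X = contradiction refl X≢X

  ι-off : ∀ s {X Y} → X ≢ Y → ι (s , X) (just Y) ≈ 0#
  ι-off s {X} {Y} X≢Y with X ≟ Y
  ... | yes X≡Y = contradiction X≡Y X≢Y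
  ... | no _    = ≈-refl

  -- `mul` keeps its summand local to a `where` block; once the seven points
  -- are generalised, unification can read it off.
  mul-just : (a b : Oct) (R : Pt) → Σ (Pt → Pt → Carrier) λ term →
    mul a b (just R) ≡ a nothing * b (just R) + a (just R) * b nothing + sumPt (λ P → sumPt (term P))
  mul-just a b R with pt zero | pt (suc zero) | pt (suc (suc zero)) | pt (suc (suc (suc zero)))
                    | pt (suc (suc (suc (suc zero)))) | pt (suc (suc (suc (suc (suc zero)))))
                    | pt (suc (suc (suc (suc (suc (suc zero))))))
  ... | _ | _ | _ | _ | _ | _ | _ = _ , refl

  term : Oct → Oct → Pt → Pt → Pt → Carrier
  term a b R = proj₁ (mul-just a b R)

  -- `with P ≟ Q` rewrites the `P ⊕ Q` hidden in `term` but not in hypotheses,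
  -- so the equation `P ⊕ Q ≡ R` enters these proofs under an opaque name.
  private opaque
    _⊕_↦_ : Pt → Pt → Pt → Set
    P ⊕ Q ↦ R = P ⊕ Q ≡ R

    box : ∀ {P Q R} → P ⊕ Q ≡ R → P ⊕ Q ↦ R
    box P⊕Q≡R = P⊕Q≡R

    unbox : ∀ {P Q R} → P ⊕ Q ↦ R → P ⊕ Q ≡ R
    unbox P⊕Q↦R = P⊕Q↦R

  private
    term-on′ : ∀ a b {R P Q} → P ≢ Q → P ⊕ Q ↦ R →
               term a b R P Q ≈ signed (ε P Q) (a (just P) * b (just Q))
    term-on′ a b {R} {P} {Q} P≢Q P⊕Q↦R with P ≟ Q
    ... | yes P≡Q = contradiction P≡Q P≢Q
    ... | no _ with (P ⊕ Q) ≟ R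
    ...   | yes _    = ≈-refl
    ...   | no P⊕Q≢R = contradiction (unbox P⊕Q↦R) P⊕Q≢R

    term-off′ : ∀ a b {R P Q} → ¬ (P ⊕ Q ↦ R) → term a b R P Q ≈ 0#
    term-off′ a b {R} {P} {Q} P⊕Q↦̸R with P ≟ Q
    ... | yes _ = ≈-refl
    ... | no _ with (P ⊕ Q) ≟ R
    ...   | yes P⊕Q≡R = contradiction (box P⊕Q≡R) P⊕Q↦̸R
    ...   | no _       = ≈-refl

  term-on : ∀ a b {R P Q} → P ≢ Q → P ⊕ Q ≡ R →
            term a b R P Q ≈ signed (ε P Q) (a (just P) * b (just Q))
  term-on a b P≢Q = term-on′ a b P≢Q ∘ box

  term-off : ∀ a b {R P Q} → P ⊕ Q ≢ R → term a b R P Q ≈ 0#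
  term-off a b P⊕Q≢R = term-off′ a b (P⊕Q≢R ∘ unbox)

  term-zeroˡ : ∀ a b {R P} Q → a (just P) ≈ 0# → term a b R P Q ≈ 0#
  term-zeroˡ a b {R} {P} Q aP≈0 with P ≟ Q
  ... | yes _ = ≈-refl
  ... | no _ with (P ⊕ Q) ≟ R
  ...   | yes _ = trans (signed-cong (ε P Q) (trans (*-congʳ aP≈0) (zeroˡ _))) (signed-0 (ε P Q))
  ...   | no _  = ≈-refl

  term-zeroʳ : ∀ a b {R} P {Q} → b (just Q) ≈ 0# → term a b R P Q ≈ 0#
  term-zeroʳ a b {R} P {Q} bQ≈0 with P ≟ Q
  ... | yes _ = ≈-refl
  ... | no _ with (P ⊕ Q) ≟ R
  ...   | yes _ = trans (signed-cong (ε P Q) (trans (*-congˡ bQ≈0) (zeroʳ _))) (signed-0 (ε P Q))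
  ...   | no _  = ≈-refl

  mul-just-supportedˡ : ∀ a b Y R → (∀ P → P ≢ Y → a (just P) ≈ 0#) → b nothing ≈ 0# →
                        mul a b (just R) ≈ a nothing * b (just R) + sumPt (term a b R Y)
  mul-just-supportedˡ a b Y R a≈0 b₀≈0 = begin
    mul a b (just R)
      ≡⟨ proj₂ (mul-just a b R) ⟩
    a nothing * b (just R) + a (just R) * b nothing + sumPt (λ P → sumPt (term a b R P))
      ≈⟨ +-cong (+-congˡ (trans (*-congˡ b₀≈0) (zeroʳ _)))
                (sumPt-single _ Y (λ P P≢Y → sumPt-zero _ (λ Q → term-zeroˡ a b Q (a≈0 P P≢Y)))) ⟩
    a nothing * b (just R) + 0# + sumPt (term a b R Y)
      ≈⟨ +-congʳ (+-identityʳ _) ⟩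
    a nothing * b (just R) + sumPt (term a b R Y)
      ∎

  mul-nothing-orthogonal : ∀ a b → b nothing ≈ 0# → (∀ P → a (just P) * b (just P) ≈ 0#) →
                           mul a b nothing ≈ 0#
  mul-nothing-orthogonal a b b₀≈0 ab≈0 = begin
    a nothing * b nothing - sumPt (λ P → a (just P) * b (just P))
      ≈⟨ +-cong (trans (*-congˡ b₀≈0) (zeroʳ _)) (-‿cong (sumPt-zero _ ab≈0)) ⟩
    0# - 0#
      ≈⟨ -‿inverseʳ 0# ⟩
    0# ∎

  ι-mul-ι : ∀ s t {X Y} → X ≢ Y → ∀ k →
            mul (ι (s , X)) (ι (t , Y)) k ≈ ι (ε X Y ·ₛ (s ·ₛ t) , X ⊕ Y) k
  ι-mul-ι s t {X} {Y} X≢Y nothing = mul-nothing-orthogonal (ι (s , X)) (ι (t , Y)) ≈-refl disjoint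
    where
    disjoint : ∀ P → ι (s , X) (just P) * ι (t , Y) (just P) ≈ 0#
    disjoint P with X ≟ P
    ... | yes refl = trans (*-congˡ (ι-off t (≢-sym X≢Y))) (zeroʳ _)
    ... | no _     = zeroˡ _
  ι-mul-ι s t {X} {Y} X≢Y (just R) = begin
    mul a b (just R)
      ≈⟨ mul-just-supportedˡ a b X R (λ P P≢X → ι-off s (≢-sym P≢X)) ≈-refl ⟩
    0# * b (just R) + sumPt (term a b R X)
      ≈⟨ +-cong (zeroˡ _) (sumPt-single _ Y (λ Q Q≢Y → term-zeroʳ a b X (ι-off t (≢-sym Q≢Y)))) ⟩
    0# + term a b R X Y
      ≈⟨ +-identityˡ _ ⟩
    term a b R X Y
      ≈⟨ term-basis ⟩
    ι (ε X Y ·ₛ (s ·ₛ t) , X ⊕ Y) (just R)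
      ∎
    where
    a b : Oct
    a = ι (s , X)
    b = ι (t , Y)
    term-basis : term a b R X Y ≈ ι (ε X Y ·ₛ (s ·ₛ t) , X ⊕ Y) (just R)
    term-basis with (X ⊕ Y) ≟ R
    ... | no X⊕Y≢R  = term-off a b X⊕Y≢R
    ... | yes X⊕Y≡R = begin
      term a b R X Y                               ≈⟨ term-on a b X≢Y X⊕Y≡R ⟩
      signed (ε X Y) (a (just X) * b (just Y))     ≈⟨ signed-cong (ε X Y) (*-cong (ι-at s X) (ι-at t Y)) ⟩
      signed (ε X Y) (signed s 1# * signed t 1#)   ≈⟨ signed-cong (ε X Y) (signed-1-* s t) ⟩
      signed (ε X Y) (signed (s ·ₛ t) 1#)          ≈⟨ signed-signed (ε X Y) (s ·ₛ t) 1# ⟩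
      signed (ε X Y ·ₛ (s ·ₛ t)) 1#                ∎

  norm-pair : ∀ c {X Z} → X ≢ Z → c nothing ≈ 0# → (∀ R → R ≢ X → R ≢ Z → c (just R) ≈ 0#) →
              norm c ≈ c (just X) * c (just X) + c (just Z) * c (just Z)
  norm-pair c {X} {Z} X≢Z c₀≈0 c≈0 = begin
    c nothing * c nothing + sumPt (λ P → c (just P) * c (just P))
      ≈⟨ +-cong (trans (*-congʳ c₀≈0) (zeroˡ _))
                (sumPt-pair _ X≢Z (λ R R≢X R≢Z → trans (*-congʳ (c≈0 R R≢X R≢Z)) (zeroˡ _))) ⟩
    0# + (c (just X) * c (just X) + c (just Z) * c (just Z))
      ≈⟨ +-identityˡ _ ⟩
    c (just X) * c (just X) + c (just Z) * c (just Z) ∎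

  two : Carrier
  two = 1# + 1#

  onePlus : Sign → Carrier
  onePlus s = 1# + signed s 1#

  square≉0 : ∀ {x} → ¬ (x ≈ 0#) → ¬ (x * x ≈ 0#)
  square≉0 {x} x≉0 x²≈0 with inverse x x≉0
  ... | y , xy≈1 = x≉0 (begin
    x            ≈⟨ *-identityʳ x ⟨
    x * 1#       ≈⟨ *-congˡ xy≈1 ⟨
    x * (x * y)  ≈⟨ *-assoc x x y ⟨
    x * x * y    ≈⟨ *-congʳ x²≈0 ⟩
    0# * y       ≈⟨ zeroˡ y ⟩
    0#           ∎)

  onePlus-squares≉4 : CharNot2 F → ∀ s → ¬ (onePlus s * onePlus s + onePlus s * onePlus s ≈ two * two)
  onePlus-squares≉4 ch2 Sign.+ 8≈4 = square≉0 ch2 (x+x≈x⇒x≈0 (two * two) 8≈4)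
  onePlus-squares≉4 ch2 Sign.- 0≈4 = square≉0 ch2 (begin
    two * two                         ≈⟨ 0≈4 ⟨
    onePlus Sign.- * onePlus Sign.- + onePlus Sign.- * onePlus Sign.-
                                      ≈⟨ +-cong 0² 0² ⟩
    0# + 0#                           ≈⟨ +-identityˡ 0# ⟩
    0#                                ∎)
    where
    0² : onePlus Sign.- * onePlus Sign.- ≈ 0#
    0² = trans (*-congʳ (-‿inverseʳ 1#)) (zeroˡ _)

  module CyclicProduct {X Y : Pt} (X≢Y : X ≢ Y) where
    Z : Pt
    Z = X ⊕ Y

    Z≢X : Z ≢ X
    Z≢X = ⊕-≢ˡ X≢Y

    Z≢Y : Z ≢ Y
    Z≢Y = ⊕-≢ʳ X≢Y

    1+eY : Oct
    1+eY nothing  = 1#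
    1+eY (just P) = ι (Sign.+ , Y) (just P)

    eX+eZ : Oct
    eX+eZ nothing  = 0#
    eX+eZ (just P) = ι (Sign.+ , X) (just P) + ι (Sign.+ , Z) (just P)

    eX+eZ-X : eX+eZ (just X) ≈ 1#
    eX+eZ-X = trans (+-cong (ι-at Sign.+ X) (ι-off Sign.+ Z≢X)) (+-identityʳ 1#)

    eX+eZ-Z : eX+eZ (just Z) ≈ 1#
    eX+eZ-Z = trans (+-cong (ι-off Sign.+ (≢-sym Z≢X)) (ι-at Sign.+ Z)) (+-identityˡ 1#)

    eX+eZ-off : ∀ R → R ≢ X → R ≢ Z → eX+eZ (just R) ≈ 0#
    eX+eZ-off R R≢X R≢Z = trans (+-cong (ι-off Sign.+ (≢-sym R≢X)) (ι-off Sign.+ (≢-sym R≢Z))) (+-identityˡ 0#)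

    product : Oct
    product = mul 1+eY eX+eZ

    product-just : ∀ R → product (just R) ≈ eX+eZ (just R) + (term 1+eY eX+eZ R Y X + term 1+eY eX+eZ R Y Z)
    product-just R = begin
      product (just R)
        ≈⟨ mul-just-supportedˡ 1+eY eX+eZ Y R (λ P P≢Y → ι-off Sign.+ (≢-sym P≢Y)) ≈-refl ⟩
      1# * eX+eZ (just R) + sumPt (term 1+eY eX+eZ R Y)
        ≈⟨ +-cong (*-identityˡ _) (sumPt-pair _ (≢-sym Z≢X) (λ Q Q≢X Q≢Z → term-zeroʳ 1+eY eX+eZ Y (eX+eZ-off Q Q≢X Q≢Z))) ⟩
      eX+eZ (just R) + (term 1+eY eX+eZ R Y X + term 1+eY eX+eZ R Y Z)
        ∎

    term-Y : ∀ {R W} → Y ≢ W → Y ⊕ W ≡ R → term 1+eY eX+eZ R Y W ≈ signed (ε Y W) (eX+eZ (just W))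
    term-Y Y≢W Y⊕W≡R =
      trans (term-on 1+eY eX+eZ Y≢W Y⊕W≡R) (signed-cong (ε Y _) (trans (*-congʳ (ι-at Sign.+ Y)) (*-identityˡ _)))

    product-X : product (just X) ≈ onePlus (ε Y Z)
    product-X = trans (product-just X) (+-cong eX+eZ-X (begin
      term 1+eY eX+eZ X Y X + term 1+eY eX+eZ X Y Z
        ≈⟨ +-cong (term-off 1+eY eX+eZ (Z≢X ∘ ≡.trans (≡.sym (⊕-comm X≢Y))))
                  (trans (term-Y (≢-sym Z≢Y) (⊕-cycle X≢Y)) (signed-cong (ε Y Z) eX+eZ-Z)) ⟩
      0# + signed (ε Y Z) 1#
        ≈⟨ +-identityˡ _ ⟩
      signed (ε Y Z) 1# ∎))

    product-Z : product (just Z) ≈ onePlus (ε Y X)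
    product-Z = trans (product-just Z) (+-cong eX+eZ-Z (begin
      term 1+eY eX+eZ Z Y X + term 1+eY eX+eZ Z Y Z
        ≈⟨ +-cong (trans (term-Y (≢-sym X≢Y) (⊕-comm X≢Y)) (signed-cong (ε Y X) eX+eZ-X))
                  (term-off 1+eY eX+eZ (Z≢X ∘ ≡.sym ∘ ≡.trans (≡.sym (⊕-cycle X≢Y)))) ⟩
      signed (ε Y X) 1# + 0#
        ≈⟨ +-identityʳ _ ⟩
      signed (ε Y X) 1# ∎))

    product-off : ∀ R → R ≢ X → R ≢ Z → product (just R) ≈ 0#
    product-off R R≢X R≢Z = begin
      product (just R)
        ≈⟨ product-just R ⟩
      eX+eZ (just R) + (term 1+eY eX+eZ R Y X + term 1+eY eX+eZ R Y Z)
        ≈⟨ +-cong (eX+eZ-off R R≢X R≢Z)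
                  (+-cong (term-off 1+eY eX+eZ (R≢Z ∘ ≡.sym ∘ ≡.trans (≡.sym (⊕-comm X≢Y))))
                          (term-off 1+eY eX+eZ (R≢X ∘ ≡.sym ∘ ≡.trans (≡.sym (⊕-cycle X≢Y))))) ⟩
      0# + (0# + 0#)
        ≈⟨ trans (+-identityˡ _) (+-identityˡ 0#) ⟩
      0# ∎

    product-nothing : product nothing ≈ 0#
    product-nothing = mul-nothing-orthogonal 1+eY eX+eZ ≈-refl orthogonal
      where
      orthogonal : ∀ P → 1+eY (just P) * eX+eZ (just P) ≈ 0#
      orthogonal P with Y ≟ P
      ... | yes refl = trans (*-congˡ (eX+eZ-off Y (≢-sym X≢Y) (≢-sym Z≢Y))) (zeroʳ _)
      ... | no _     = zeroˡ _

    norm-product : norm product ≈ onePlus (ε Y Z) * onePlus (ε Y Z) + onePlus (ε Y X) * onePlus (ε Y X)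
    norm-product = trans (norm-pair product (≢-sym Z≢X) product-nothing product-off)
                         (+-cong (*-cong product-X product-X) (*-cong product-Z product-Z))

    norm-1+eY : norm 1+eY ≈ two
    norm-1+eY = +-cong (*-identityˡ 1#) (begin
      sumPt (λ P → 1+eY (just P) * 1+eY (just P))
        ≈⟨ sumPt-single (λ P → 1+eY (just P) * 1+eY (just P)) Y
                        (λ P P≢Y → trans (*-congʳ (ι-off Sign.+ (≢-sym P≢Y))) (zeroˡ _)) ⟩
      1+eY (just Y) * 1+eY (just Y)
        ≈⟨ trans (*-cong (ι-at Sign.+ Y) (ι-at Sign.+ Y)) (*-identityˡ 1#) ⟩
      1# ∎)

    norm-eX+eZ : norm eX+eZ ≈ two
    norm-eX+eZ = trans (norm-pair eX+eZ (≢-sym Z≢X) ≈-refl eX+eZ-off)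
                       (+-cong (square-1 eX+eZ-X) (square-1 eX+eZ-Z))
      where
      square-1 : ∀ {x} → x ≈ 1# → x * x ≈ 1#
      square-1 x≈1 = trans (*-cong x≈1 x≈1) (*-identityˡ 1#)

  ε-cyclic : CharNot2 F → IsCompositionFactor → ∀ {X Y} → X ≢ Y → ε X Y ≡ ε Y (X ⊕ Y)
  ε-cyclic ch2 (antisym , multiplicative) {X} {Y} X≢Y =
    ≡.sym (≡.trans (≢⇒≡opposite εYZ≢εYX)
                   (≡.trans (≡.cong opposite (antisym X Y X≢Y)) (Signₚ.opposite-involutive (ε X Y))))
    where
    open CyclicProduct X≢Y
    squares≈4 : onePlus (ε Y Z) * onePlus (ε Y Z) + onePlus (ε Y X) * onePlus (ε Y X) ≈ two * two
    squares≈4 = trans (sym norm-product) (trans (multiplicative 1+eY eX+eZ) (*-cong norm-1+eY norm-eX+eZ))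
    εYZ≢εYX : ε Y Z ≢ ε Y X
    εYZ≢εYX εYZ≡εYX = onePlus-squares≉4 ch2 (ε Y X)
      (≡.subst (λ s → onePlus s * onePlus s + onePlus (ε Y X) * onePlus (ε Y X) ≈ two * two) εYZ≡εYX squares≈4)

-- Lifts of Fano automorphisms

module GhatCharacterisation {c ℓ} (F : Field c ℓ) (ch2 : CharNot2 F) (𝓕 : FanoPlane)
  (ε : Point 𝓕 → Point 𝓕 → Sign) (comp : Octonions.IsCompositionFactor F 𝓕 ε)
  (g : Point 𝓕 → Point 𝓕) (aut : IsFanoAut 𝓕 g) (δ̃ : Point 𝓕 → Sign) where
  open Field F using (_≈_; 1#; setoid)
  open Octonions F 𝓕 ε
  open FanoPlane 𝓕 using (_∈ₗ_) renaming (_+_ to _⊕_)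
  open FanoGeometry 𝓕
  open OctonionAlgebra F 𝓕 ε

  private
    Pt : Set
    Pt = Point 𝓕

  δ* : Pt → Pt → Sign
  δ* P Q = ε P Q ·ₛ ε (g P) (g Q)

  δ̃△ : Pt → Pt → Sign
  δ̃△ P Q = δ̃ P ·ₛ δ̃ Q ·ₛ δ̃ (P ⊕ Q)

  PairCondition : Set
  PairCondition = ∀ {P Q} → P ≢ Q → δ* P Q ≡ δ̃△ P Q

  LineCondition : Set
  LineCondition = ∀ (D : Fin 7) → OnLineTriple 𝓕 D (λ P Q R → deltaStar 𝓕 ε g D ≡ δ̃ P ·ₛ δ̃ Q ·ₛ δ̃ R)

  δ*-swap : ∀ {P Q} → P ≢ Q → δ* Q P ≡ δ* P Q
  δ*-swap {P} {Q} P≢Q = ≡.trans (≡.cong₂ _·ₛ_ (antisym P Q P≢Q) (antisym (g P) (g Q) (aut-≢ aut P≢Q)))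
                                (opposite-·ₛ-opposite (ε P Q) (ε (g P) (g Q)))
    where
    antisym : IsMultiplicationFactor 𝓕 ε
    antisym = proj₁ comp

  δ*-cycle : ∀ {P Q} → P ≢ Q → δ* Q (P ⊕ Q) ≡ δ* P Q
  δ*-cycle {P} {Q} P≢Q = ≡.cong₂ _·ₛ_
    (≡.sym (ε-cyclic ch2 comp P≢Q))
    (≡.trans (≡.cong (ε (g Q)) (aut-⊕ aut P≢Q)) (≡.sym (ε-cyclic ch2 comp (aut-≢ aut P≢Q))))

  δ̃△-swap : ∀ {P Q} → P ≢ Q → δ̃△ Q P ≡ δ̃△ P Q
  δ̃△-swap {P} {Q} P≢Q = ≡.cong₂ _·ₛ_ (Signₚ.*-comm (δ̃ Q) (δ̃ P)) (≡.cong δ̃ (⊕-comm P≢Q))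

  δ̃△-cycle : ∀ {P Q} → P ≢ Q → δ̃△ Q (P ⊕ Q) ≡ δ̃△ P Q
  δ̃△-cycle {P} {Q} P≢Q = ≡.trans (≡.cong (λ X → δ̃ Q ·ₛ δ̃ (P ⊕ Q) ·ₛ δ̃ X) (⊕-cycle P≢Q))
    (≡.trans (Signₚ.*-comm (δ̃ Q ·ₛ δ̃ (P ⊕ Q)) (δ̃ P)) (≡.sym (Signₚ.*-assoc (δ̃ P) (δ̃ Q) (δ̃ (P ⊕ Q)))))

  LiftCondition : Pt → Pt → Set ℓ
  LiftCondition P Q =
    ∀ k → ι (ghat g δ̃ (ε P Q , P ⊕ Q)) k ≈ mul (ι (ghat g δ̃ (Sign.+ , P))) (ι (ghat g δ̃ (Sign.+ , Q))) k

  SignCondition : Pt → Pt → Set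
  SignCondition P Q = ε P Q ·ₛ δ̃ (P ⊕ Q) ≡ ε (g P) (g Q) ·ₛ (δ̃ P ·ₛ δ̃ Q)

  ghat-pair⇔ : ∀ {P Q} → P ≢ Q → LiftCondition P Q ⇔ SignCondition P Q
  ghat-pair⇔ {P} {Q} P≢Q = mk⇔ signs-agree lift-agrees
    where
    open SetoidReasoning setoid
    gP≢gQ : g P ≢ g Q
    gP≢gQ = aut-≢ aut P≢Q
    W : Pt
    W = g P ⊕ g Q
    signs-agree : LiftCondition P Q → SignCondition P Q
    signs-agree ι≈ = signed-1-injective ch2 (begin
      signed (ε P Q ·ₛ δ̃ (P ⊕ Q)) 1#                  ≈⟨ ι-at _ W ⟨
      ι (ε P Q ·ₛ δ̃ (P ⊕ Q) , W) (just W)             ≡⟨ ≡.cong (λ V → ι (_ , V) (just W)) (aut-⊕ aut P≢Q) ⟨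
      ι (ε P Q ·ₛ δ̃ (P ⊕ Q) , g (P ⊕ Q)) (just W)     ≈⟨ ι≈ (just W) ⟩
      mul (ι (δ̃ P , g P)) (ι (δ̃ Q , g Q)) (just W)    ≈⟨ ι-mul-ι (δ̃ P) (δ̃ Q) gP≢gQ (just W) ⟩
      ι (ε (g P) (g Q) ·ₛ (δ̃ P ·ₛ δ̃ Q) , W) (just W)  ≈⟨ ι-at _ W ⟩
      signed (ε (g P) (g Q) ·ₛ (δ̃ P ·ₛ δ̃ Q)) 1#       ∎)
    lift-agrees : SignCondition P Q → LiftCondition P Q
    lift-agrees signs≡ k = begin
      ι (ε P Q ·ₛ δ̃ (P ⊕ Q) , g (P ⊕ Q)) k            ≡⟨ ≡.cong₂ (λ s V → ι (s , V) k) signs≡ (aut-⊕ aut P≢Q) ⟩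
      ι (ε (g P) (g Q) ·ₛ (δ̃ P ·ₛ δ̃ Q) , W) k         ≈⟨ ι-mul-ι (δ̃ P) (δ̃ Q) gP≢gQ k ⟨
      mul (ι (δ̃ P , g P)) (ι (δ̃ Q , g Q)) k           ∎

  isAutHat⇔pairs : IsAutHat (ghat g δ̃) ⇔ PairCondition
  isAutHat⇔pairs = mk⇔
    (λ isAut {P} {Q} P≢Q → Equivalence.to (pair⇔ P≢Q) (proj₂ isAut P Q P≢Q))
    (λ pairs → (λ _ → refl) , λ _ _ P≢Q → Equivalence.from (pair⇔ P≢Q) (pairs P≢Q))
    where
    pair⇔ : ∀ {P Q} → P ≢ Q → LiftCondition P Q ⇔ (δ* P Q ≡ δ̃△ P Q)
    pair⇔ {P} {Q} P≢Q = ·ₛ-transpose (ε P Q) (ε (g P) (g Q)) (δ̃ (P ⊕ Q)) (δ̃ P ·ₛ δ̃ Q) ⇔-∘ ghat-pair⇔ P≢Q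

  pairs⇔lines : PairCondition ⇔ LineCondition
  pairs⇔lines = mk⇔ pairs⇒lines lines⇒pairs
    where
    pairs⇒lines : PairCondition → LineCondition
    pairs⇒lines pairs D = ≡.trans (pairs A≢B) (≡.cong (λ R → δ̃ A ·ₛ δ̃ B ·ₛ δ̃ R) A⊕B≡C)
      where open LinePoints D

    pairs-on-line : LineCondition → ∀ L {P Q} → P ∈ₗ L → Q ∈ₗ L → P ≢ Q → δ* P Q ≡ δ̃△ P Q
    pairs-on-line lines L {P} {Q} P∈L Q∈L P≢Q = begin
      δ* P Q             ≡⟨ line-invariant δ* δ*-swap δ*-cycle L P∈L Q∈L P≢Q ⟩
      δ* A B             ≡⟨ lines L ⟩
      δ̃ A ·ₛ δ̃ B ·ₛ δ̃ C  ≡⟨ ≡.cong (λ R → δ̃ A ·ₛ δ̃ B ·ₛ δ̃ R) A⊕B≡C ⟨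
      δ̃△ A B             ≡⟨ line-invariant δ̃△ δ̃△-swap δ̃△-cycle L P∈L Q∈L P≢Q ⟨
      δ̃△ P Q             ∎
      where
      open ≡.≡-Reasoning
      open LinePoints L

    lines⇒pairs : LineCondition → PairCondition
    lines⇒pairs lines P≢Q = let L , P∈L , Q∈L = line-through P≢Q in pairs-on-line lines L P∈L Q∈L P≢Q

proposition2p40 : ∀ {c ℓ} (F : Field c ℓ) → CharNot2 F →
    (𝓕 : FanoPlane) (ε : Point 𝓕 → Point 𝓕 → Sign) →
    Octonions.IsCompositionFactor F 𝓕 ε →
    (g : Point 𝓕 → Point 𝓕) → IsFanoAut 𝓕 g →
    (δ̃ : Point 𝓕 → Sign) →
    (Octonions.IsAutHat F 𝓕 ε (Octonions.ghat F 𝓕 ε g δ̃)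
       ⇔ (∀ (D : Fin 7) → OnLineTriple 𝓕 D (λ P Q R →
             deltaStar 𝓕 ε g D ≡ δ̃ P ·ₛ δ̃ Q ·ₛ δ̃ R)))
    × (Octonions.IsAutHat F 𝓕 ε (Octonions.ghat F 𝓕 ε g δ̃) →
       ∀ P → Octonions.πHat F 𝓕 ε (Octonions.ghat F 𝓕 ε g δ̃) P ≡ g P)
proposition2p40 F ch2 𝓕 ε comp g aut δ̃ = pairs⇔lines ⇔-∘ isAutHat⇔pairs , λ _ _ → refl
  where open GhatCharacterisation F ch2 𝓕 ε comp g aut δ̃
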